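{- Let $R$ be a function from a recursive subset of $\mathbb{N}^2$ to $\mathbb{N}$ such that $R(n,w)\in B^n$ whenever defined, and let $r>1$ be a natural number. Then there exists a coloring function $c:\mathbb{N}\rightarrow\{0,\dots,r-1\}$, uniformly recursive in $R$, such that for any $w\in\mathbb{Z}^+$ and any $n<\lambda(w)$, if $R(n,w)$ is defined then $c(w+R(n,w))\equiv c(w)+1 \pmod r$.
   Context: For $x=\sum_{i=0}^{k}2^{n_i}\in\mathbb{Z}^+$ with $n_0<\dots<n_k$, set $\mu(x)=n_k$ and $\lambda(x)=n_0$. For $n\in\mathbb{N}$, $B^n=\{x\in\mathbb{Z}^+:\mu(x)=n\}$. -}

module Defs where

open import Data.Nat using (ℕ; zero; suc; _<_; _%_; _/_; NonZero)
open import Data.Nat.Logarithm using (⌊log₂_⌋)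
open import Data.Product using (_×_)
open import Relation.Binary.PropositionalEquality using (_≡_)

-- μ(x) = index of the highest binary digit of x (meaningful for x > 0)
μ : ℕ → ℕ
μ x = ⌊log₂ x ⌋

-- λ(x) = index of the lowest binary digit of x (meaningful for x > 0);
-- computed by repeatedly halving while even, with fuel x (enough for x > 0).
lowAux : ℕ → ℕ → ℕ
lowAux zero    x = 0
lowAux (suc f) zero = 0
lowAux (suc f) (suc x) with suc x % 2
... | zero  = suc (lowAux f (suc x / 2))
... | suc _ = 0

λ₂ : ℕ → ℕ
λ₂ x = lowAux x x

B : ℕ → ℕ → Set
B n x = (0 < x) × (μ x ≡ n)

_≡_[mod_] : ℕ → ℕ → (r : ℕ) → .{{NonZero r}} → Set
a ≡ b [mod r ] = a % r ≡ b % r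

-- Let value x be the number of jumps collected when the binary digits of x are added, highest
-- first, to 0, where adding the digit 2ⁿ to a partial sum w collects a jump of size
-- 1 + (r − 1)·S if R n w = y and S is what the lower digits of y collect from w + 2ⁿ. If 2ⁿ⁺¹
-- divides w and y ∈ Bⁿ, the digits of y all lie below those of w, so going from w to w + y
-- collects exactly that jump followed by S: in total 1 + r·S ≡ 1 (mod r).
module Submission where

open import Defs
open import Data.Nat using (ℕ; zero; suc; pred; _+_; _*_; _∸_; _^_; _<_; _≤_; _≤?_; s≤s; z≤n; NonZero; _%_; _/_; ⌊_/2⌋; ⌈_/2⌉)
open import Data.Nat.Properties
open import Data.Nat.DivMod using (_mod_; m%n%n≡m%n; [m+kn]%n≡m%n; m%n<n; %-distribˡ-+; m*[n/m]≡n)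
open import Data.Nat.Divisibility using (_∣_; divides; m%n≡0⇒n∣m; *-monoʳ-∣)
open import Data.Nat.Logarithm using (⌊log₂_⌋; ⌊log₂⌋-mono-≤; ⌊log₂⌊n/2⌋⌋≡⌊log₂n⌋∸1; ⌊log₂[2^n]⌋≡n)
open import Data.Fin using (Fin; toℕ)
open import Data.Fin.Properties using (toℕ-fromℕ<)
open import Data.Maybe using (Maybe; just; nothing)
open import Data.Product using (Σ; ∃-syntax; _×_; _,_)
open import Data.Sum using (inj₁; inj₂)
open import Relation.Nullary using (Dec; yes; no; contradiction)
open import Relation.Binary.PropositionalEquality using (_≡_; refl; sym; trans; cong; cong₂; subst; subst₂; module ≡-Reasoning)

2^[1+n]≡2^n+2^n : ∀ n → 2 ^ suc n ≡ 2 ^ n + 2 ^ n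
2^[1+n]≡2^n+2^n n = cong (2 ^ n +_) (+-identityʳ (2 ^ n))

n<2^n : ∀ n → n < 2 ^ n
n<2^n zero    = s≤s z≤n
n<2^n (suc n) = begin-strict
  suc n           <⟨ s≤s (n<2^n n) ⟩
  suc (2 ^ n)     ≤⟨ +-monoˡ-≤ (2 ^ n) (m^n>0 2 n) ⟩
  2 ^ n + 2 ^ n   ≡⟨ 2^[1+n]≡2^n+2^n n ⟨
  2 ^ suc n       ∎
  where open ≤-Reasoning

q*2^m+y<2^[j+m] : ∀ j m {q y} → q < 2 ^ j → y < 2 ^ m → q * 2 ^ m + y < 2 ^ (j + m)
q*2^m+y<2^[j+m] j m {q} {y} q<2^j y<2^m = begin-strict
  q * 2 ^ m + y       <⟨ +-monoʳ-< (q * 2 ^ m) y<2^m ⟩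
  q * 2 ^ m + 2 ^ m   ≡⟨ +-comm (q * 2 ^ m) (2 ^ m) ⟩
  suc q * 2 ^ m       ≤⟨ *-monoˡ-≤ (2 ^ m) q<2^j ⟩
  2 ^ j * 2 ^ m       ≡⟨ ^-distribˡ-+-* 2 j m ⟨
  2 ^ (j + m)         ∎
  where open ≤-Reasoning

[1+m%n]%n≡[1+m]%n : ∀ m n .{{_ : NonZero n}} → suc (m % n) % n ≡ suc m % n
[1+m%n]%n≡[1+m]%n m n = begin
  (1 + m % n) % n           ≡⟨ %-distribˡ-+ 1 (m % n) n ⟩
  (1 % n + m % n % n) % n   ≡⟨ cong (λ t → (1 % n + t) % n) (m%n%n≡m%n m n) ⟩
  (1 % n + m % n) % n       ≡⟨ %-distribˡ-+ 1 m n ⟨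
  (1 + m) % n               ∎
  where open ≡-Reasoning

lowAux-divides : ∀ f x n → n < lowAux f x → 2 ^ suc n ∣ x
lowAux-divides (suc f) (suc x) n n<low with suc x % 2 in x%2≡0
... | zero = halving n n<low
  where
  halving : ∀ n → n < suc (lowAux f (suc x / 2)) → 2 ^ suc n ∣ suc x
  halving zero    _            = m%n≡0⇒n∣m (suc x) 2 x%2≡0
  halving (suc n) (s≤s n<low′) =
    subst (2 ^ suc (suc n) ∣_) (m*[n/m]≡n (m%n≡0⇒n∣m (suc x) 2 x%2≡0))
          (*-monoʳ-∣ 2 (lowAux-divides f (suc x / 2) n n<low′))
... | suc _ = contradiction n<low λ ()

λ₂-divides : ∀ {n w} → n < λ₂ w → 2 ^ suc n ∣ w
λ₂-divides {n} {w} = lowAux-divides w w n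

⌊n/2⌋<2^k : ∀ k n → n < 2 ^ suc k → ⌊ n /2⌋ < 2 ^ k
⌊n/2⌋<2^k k n n<2^[1+k] = ≰⇒> λ 2^k≤⌊n/2⌋ → <⇒≱ n<2^[1+k] (begin
  2 ^ suc k             ≡⟨ 2^[1+n]≡2^n+2^n k ⟩
  2 ^ k + 2 ^ k         ≤⟨ +-mono-≤ 2^k≤⌊n/2⌋ (≤-trans 2^k≤⌊n/2⌋ (⌊n/2⌋≤⌈n/2⌉ n)) ⟩
  ⌊ n /2⌋ + ⌈ n /2⌉     ≡⟨ ⌊n/2⌋+⌈n/2⌉≡n n ⟩
  n                     ∎)
  where open ≤-Reasoning

⌊log₂⌋<⁺ : ∀ k n → 0 < n → n < 2 ^ k → ⌊log₂ n ⌋ < k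
⌊log₂⌋<⁺ zero    (suc zero)    _ (s≤s ())
⌊log₂⌋<⁺ zero    (suc (suc n)) _ (s≤s ())
⌊log₂⌋<⁺ (suc k) (suc zero)    _ _ = s≤s z≤n
⌊log₂⌋<⁺ (suc k) (suc (suc n)) _ n<2^[1+k] = m∸1<n⇒m<1+n
  (subst (_< k) (⌊log₂⌊n/2⌋⌋≡⌊log₂n⌋∸1 (2 + n))
         (⌊log₂⌋<⁺ k (suc ⌊ n /2⌋) (s≤s z≤n) (⌊n/2⌋<2^k k (2 + n) n<2^[1+k])))
  where
  m∸1<n⇒m<1+n : ∀ {m n} → m ∸ 1 < n → m < suc n
  m∸1<n⇒m<1+n {zero}  _   = s≤s z≤n
  m∸1<n⇒m<1+n {suc m} m<n = s≤s m<n

B-decompose : ∀ {n y} → B n y → ∃[ y′ ] y′ < 2 ^ n × 2 ^ n + y′ ≡ y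
B-decompose {n} {y} (0<y , μy≡n) = y ∸ 2 ^ n , y∸2^n<2^n , m+[n∸m]≡n 2^n≤y
  where
  2^n≤y : 2 ^ n ≤ y
  2^n≤y = ≮⇒≥ λ y<2^n → <-irrefl μy≡n (⌊log₂⌋<⁺ n y 0<y y<2^n)
  y<2^[1+n] : y < 2 ^ suc n
  y<2^[1+n] = ≰⇒> λ 2^[1+n]≤y →
    <-irrefl refl (subst₂ _≤_ (⌊log₂[2^n]⌋≡n (suc n)) μy≡n (⌊log₂⌋-mono-≤ 2^[1+n]≤y))
  y∸2^n<2^n : y ∸ 2 ^ n < 2 ^ n
  y∸2^n<2^n = +-cancelˡ-< (2 ^ n) (y ∸ 2 ^ n) (2 ^ n)
    (subst₂ _<_ (sym (m+[n∸m]≡n 2^n≤y)) (2^[1+n]≡2^n+2^n n) y<2^[1+n])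

module Colouring (R : ℕ → ℕ → Maybe ℕ) (r : ℕ) where

  mutual
    jump : ℕ → ℕ → ℕ
    jump n w = jumpOf n w (R n w)

    jumpOf : ℕ → ℕ → Maybe ℕ → ℕ
    jumpOf n w nothing  = 0
    jumpOf n w (just y) = 1 + pred r * potential n (w + 2 ^ n) (y ∸ 2 ^ n)

    -- potential k w v: the jumps collected by adding to w the binary digits of v below 2ᵏ.
    potential : ℕ → ℕ → ℕ → ℕ
    potential zero    w v = 0
    potential (suc k) w v = potentialStep k w v (2 ^ k ≤? v)

    potentialStep : (k w v : ℕ) → Dec (2 ^ k ≤ v) → ℕ
    potentialStep k w v (yes _) = jump k w + potential k (w + 2 ^ k) (v ∸ 2 ^ k)
    potentialStep k w v (no _)  = potential k w v

  potential-high : ∀ k w v → potential (suc k) w (2 ^ k + v) ≡ jump k w + potential k (w + 2 ^ k) v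
  potential-high k w v with 2 ^ k ≤? 2 ^ k + v
  ... | yes _     = cong (λ t → jump k w + potential k (w + 2 ^ k) t) (m+n∸m≡n (2 ^ k) v)
  ... | no 2^k≰v  = contradiction (m≤m+n (2 ^ k) v) 2^k≰v

  potential-low : ∀ k w v → v < 2 ^ k → potential (suc k) w v ≡ potential k w v
  potential-low k w v v<2^k with 2 ^ k ≤? v
  ... | yes 2^k≤v = contradiction 2^k≤v (<⇒≱ v<2^k)
  ... | no _      = refl

  potential-zero : ∀ k w → potential k w 0 ≡ 0
  potential-zero zero    w = refl
  potential-zero (suc k) w = trans (potential-low k w 0 (m^n>0 2 k)) (potential-zero k w)

  potential-stable : ∀ {k l} w v → v < 2 ^ k → k ≤ l → potential l w v ≡ potential k w v
  potential-stable {l = zero}  w v _ z≤n = refl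
  potential-stable {l = suc l} w v v<2^k k≤1+l with m≤n⇒m<n∨m≡n k≤1+l
  ... | inj₂ refl       = refl
  ... | inj₁ (s≤s k≤l) =
    trans (potential-low l w v (<-≤-trans v<2^k (^-monoʳ-≤ 2 k≤l))) (potential-stable w v v<2^k k≤l)

  potential-split : ∀ m j q w y → q < 2 ^ j → y < 2 ^ m →
    potential (j + m) w (q * 2 ^ m + y) ≡ potential (j + m) w (q * 2 ^ m) + potential m (w + q * 2 ^ m) y
  potential-split m zero zero w y _ _ =
    sym (cong₂ _+_ (potential-zero m w) (cong (λ t → potential m t y) (+-identityʳ w)))
  potential-split m zero (suc q) w y (s≤s ()) _
  potential-split m (suc j) q w y q<2^[1+j] y<2^m with 2 ^ j ≤? q
  ... | no 2^j≰q = begin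
    potential (suc (j + m)) w (q * M + y)
      ≡⟨ potential-low (j + m) w _ (q*2^m+y<2^[j+m] j m q<2^j y<2^m) ⟩
    potential (j + m) w (q * M + y)
      ≡⟨ potential-split m j q w y q<2^j y<2^m ⟩
    potential (j + m) w (q * M) + potential m (w + q * M) y
      ≡⟨ cong (_+ potential m (w + q * M) y) (potential-low (j + m) w _ q*M<2^[j+m]) ⟨
    potential (suc (j + m)) w (q * M) + potential m (w + q * M) y ∎
    where
    open ≡-Reasoning
    M = 2 ^ m
    q<2^j : q < 2 ^ j
    q<2^j = ≰⇒> 2^j≰q
    q*M<2^[j+m] : q * M < 2 ^ (j + m)
    q*M<2^[j+m] = ≤-<-trans (m≤m+n (q * M) y) (q*2^m+y<2^[j+m] j m q<2^j y<2^m)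
  ... | yes 2^j≤q with q′ , refl ← m≤n⇒∃[o]m+o≡n 2^j≤q = begin
    potential (suc (j + m)) w ((2 ^ j + q′) * M + y)
      ≡⟨ cong (potential (suc (j + m)) w) (trans (cong (_+ y) spread) (+-assoc (2 ^ (j + m)) _ y)) ⟩
    potential (suc (j + m)) w (2 ^ (j + m) + (q′ * M + y))
      ≡⟨ potential-high (j + m) w _ ⟩
    jump (j + m) w + potential (j + m) w′ (q′ * M + y)
      ≡⟨ cong (jump (j + m) w +_) (potential-split m j q′ w′ y q′<2^j y<2^m) ⟩
    jump (j + m) w + (potential (j + m) w′ (q′ * M) + potential m (w′ + q′ * M) y)
      ≡⟨ +-assoc (jump (j + m) w) _ _ ⟨
    jump (j + m) w + potential (j + m) w′ (q′ * M) + potential m (w′ + q′ * M) y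
      ≡⟨ cong₂ _+_ (potential-high (j + m) w (q′ * M)) (cong (λ t → potential m t y) (sym (+-assoc w _ _))) ⟨
    potential (suc (j + m)) w (2 ^ (j + m) + q′ * M) + potential m (w + (2 ^ (j + m) + q′ * M)) y
      ≡⟨ cong (λ t → potential (suc (j + m)) w t + potential m (w + t) y) spread ⟨
    potential (suc (j + m)) w ((2 ^ j + q′) * M) + potential m (w + (2 ^ j + q′) * M) y ∎
    where
    open ≡-Reasoning
    M = 2 ^ m
    w′ = w + 2 ^ (j + m)
    spread : (2 ^ j + q′) * M ≡ 2 ^ (j + m) + q′ * M
    spread = trans (*-distribʳ-+ M (2 ^ j) q′) (cong (_+ q′ * M) (sym (^-distribˡ-+-* 2 j m)))
    q′<2^j : q′ < 2 ^ j
    q′<2^j = +-cancelˡ-< (2 ^ j) q′ (2 ^ j) (subst (2 ^ j + q′ <_) (2^[1+n]≡2^n+2^n j) q<2^[1+j])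

  value : ℕ → ℕ
  value x = potential x 0 x

  value≡potential : ∀ {x} l → x < 2 ^ l → value x ≡ potential l 0 x
  value≡potential {x} l x<2^l with ≤-total x l
  ... | inj₁ x≤l = sym (potential-stable 0 x (n<2^n x) x≤l)
  ... | inj₂ l≤x = potential-stable 0 x x<2^l l≤x

  value-split : ∀ m q y → y < 2 ^ m → value (q * 2 ^ m + y) ≡ value (q * 2 ^ m) + potential m (q * 2 ^ m) y
  value-split m q y y<2^m = begin
    value (q * 2 ^ m + y)
      ≡⟨ value≡potential (q + m) (q*2^m+y<2^[j+m] q m (n<2^n q) y<2^m) ⟩
    potential (q + m) 0 (q * 2 ^ m + y)
      ≡⟨ potential-split m q q 0 y (n<2^n q) y<2^m ⟩
    potential (q + m) 0 (q * 2 ^ m) + potential m (q * 2 ^ m) y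
      ≡⟨ cong (_+ potential m (q * 2 ^ m) y) (value≡potential (q + m) q*2^m<2^[q+m]) ⟨
    value (q * 2 ^ m) + potential m (q * 2 ^ m) y ∎
    where
    open ≡-Reasoning
    q*2^m<2^[q+m] : q * 2 ^ m < 2 ^ (q + m)
    q*2^m<2^[q+m] = ≤-<-trans (m≤m+n (q * 2 ^ m) y) (q*2^m+y<2^[j+m] q m (n<2^n q) y<2^m)

  value-jump : ∀ .{{_ : NonZero r}} {n w y} → 2 ^ suc n ∣ w → y < 2 ^ n → R n w ≡ just (2 ^ n + y) →
    value (w + (2 ^ n + y)) ≡ suc (value w) + potential n (w + 2 ^ n) y * r
  value-jump {n} {w} {y} (divides q refl) y<2^n Rnw≡y = begin
    value (w + (2 ^ n + y))
      ≡⟨ value-split (suc n) q (2 ^ n + y) 2^n+y<2^[1+n] ⟩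
    value w + potential (suc n) w (2 ^ n + y)
      ≡⟨ cong (value w +_) (potential-high n w y) ⟩
    value w + (jumpOf n w (R n w) + S)
      ≡⟨ cong (λ t → value w + (jumpOf n w t + S)) Rnw≡y ⟩
    value w + (1 + pred r * potential n (w + 2 ^ n) (2 ^ n + y ∸ 2 ^ n) + S)
      ≡⟨ cong (λ t → value w + (1 + pred r * potential n (w + 2 ^ n) t + S)) (m+n∸m≡n (2 ^ n) y) ⟩
    value w + suc (pred r * S + S)
      ≡⟨ +-suc (value w) _ ⟩
    suc (value w + (pred r * S + S))
      ≡⟨ cong (λ t → suc (value w + t)) (+-comm (pred r * S) S) ⟩
    suc (value w + suc (pred r) * S)
      ≡⟨ cong (λ t → suc (value w + t * S)) (suc-pred r) ⟩
    suc (value w + r * S)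
      ≡⟨ cong (λ t → suc (value w + t)) (*-comm r S) ⟩
    suc (value w) + S * r ∎
    where
    open ≡-Reasoning
    S = potential n (w + 2 ^ n) y
    2^n+y<2^[1+n] : 2 ^ n + y < 2 ^ suc n
    2^n+y<2^[1+n] = subst (2 ^ n + y <_) (sym (2^[1+n]≡2^n+2^n n)) (+-monoʳ-< (2 ^ n) y<2^n)

mainTheorem7 : (R : ℕ → ℕ → Maybe ℕ) → (∀ n w y → R n w ≡ just y → B n y) → (r : ℕ) → .{{_ : NonZero r}} → 1 < r → Σ (ℕ → Fin r) (λ c → ∀ w → 0 < w → ∀ n → n < λ₂ w → ∀ y → R n w ≡ just y → toℕ (c (w + y)) ≡ suc (toℕ (c w)) [mod r ])
mainTheorem7 R R∈B r _ = colour , colour-step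
  where
  open Colouring R r
  colour : ℕ → Fin r
  colour x = value x mod r
  toℕ-colour : ∀ x → toℕ (colour x) ≡ value x % r
  toℕ-colour x = toℕ-fromℕ< (m%n<n (value x) r)
  colour-step : ∀ w → 0 < w → ∀ n → n < λ₂ w → ∀ y → R n w ≡ just y → toℕ (colour (w + y)) ≡ suc (toℕ (colour w)) [mod r ]
  colour-step w _ n n<λw y Rnw≡y with y′ , y′<2^n , refl ← B-decompose (R∈B n w y Rnw≡y) = begin
    toℕ (colour (w + y)) % r                       ≡⟨ cong (_% r) (toℕ-colour (w + y)) ⟩
    value (w + y) % r % r                          ≡⟨ m%n%n≡m%n (value (w + y)) r ⟩
    value (w + y) % r                              ≡⟨ cong (_% r) (value-jump (λ₂-divides n<λw) y′<2^n Rnw≡y) ⟩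
    (suc (value w) + potential n (w + 2 ^ n) y′ * r) % r  ≡⟨ [m+kn]%n≡m%n (suc (value w)) (potential n (w + 2 ^ n) y′) r ⟩
    suc (value w) % r                              ≡⟨ [1+m%n]%n≡[1+m]%n (value w) r ⟨
    suc (value w % r) % r                          ≡⟨ cong (λ t → suc t % r) (toℕ-colour w) ⟨
    suc (toℕ (colour w)) % r                       ∎
    where open ≡-Reasoning
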